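{- Let $p\ge 2$ be an even integer, $m\ge 3$ an odd integer, and let $G$ be a $(p,q)$-graph with $V(G)=\{u_i\mid 1\le i\le p\}$. Suppose the following three conditions hold. (a) For some $t\ge 2$, $G$ is a $t$-partite graph with partite sets $V_l$, $1\le l\le t$, such that $|V_l|=s_l$ with $s_{l+1}\ge s_l\ge 1$. (b) $G$ admits a bijective total labeling $g:V(G)\cup E(G)\to[1,p+q]$, with induced color of $u$ given by $g^+_{tn}(u)=\sum_{x\in N(u)}[g(ux)+g(x)]$, such that for each $1\le l\le t$: if $s_l=1$, then the only induced color in $V_l$ is $\alpha_l$; and if $s_l\ge 2$, then all the induced colors of the vertices of $V_l$ form (in some order) an arithmetic sequence with first term $\alpha_l$ and common difference $d_l$. (A) There exists a $p\times m$ matrix $A_{p\times m}$ whose set of entries is $[1,pm]$, all of whose column sums are equal to the constant $p(pm+1)/2$, and whose $p$ row sums (one for each row) can be partitioned into $t$ collections $S_l$, $1\le l\le t$, with $S_l$ of size $s_l$, such that: if $s_l=1$, then the only element of $S_l$ is $\beta_l$; and if $s_l\ge 2$, then all the elements of $S_l$ form (in some order) an arithmetic sequence with first term $\beta_l$ and common difference $-d_l$. Let $H$ be an $(m,\nu)$-graph with $V(H)=\{v_j\mid 1\le j\le m\}$ and $\chi(H)=\chi_{ltna}(H)=t'\ge 2$, and let $h$ be a local total neighborhood antimagic $t'$-coloring of $H$. Suppose that (i) $\alpha_l+\beta_l\ne\alpha_{l'}+\beta_{l'}$ for all $1\le l<l'\le t$; (ii) for all $1\le l\le t$ and $1\le j\le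 m$, $$\alpha_l+\beta_l+m(2p+2q+pm)+\sum_{k=1}^m h(v_k)\ne\sum_{i=1}^p g(u_i)+\frac{p(pm+1)}{2}+p(p+q)+h^+_{tn}(v_j)+2d_H(v_j)(p+q+pm);$$ (iii) for all $1\le j\ne j'\le m$, $h^+_{tn}(v_j)=h^+_{tn}(v_{j'})$ implies $d_H(v_j)=d_H(v_{j'})$; (iv) for all $1\le j\ne j'\le m$, $h^+_{tn}(v_j)\ne h^+_{tn}(v_{j'})$ implies $h^+_{tn}(v_j)-h^+_{tn}(v_{j'})\ne 2(p+q+pm)[d_H(v_{j'})-d_H(v_j)]$. Then $\chi_{ltna}(G\vee H)\le t+t'$. Equality holds if $\chi(G)=t$.
   Context: All graphs are finite and simple. A $(p,q)$-graph is a graph with $p$ vertices and $q$ edges. For integers $a<b$, $[a,b]=\{a,a+1,\dots,b\}$. $N(u)$ is the set of neighbors of $u$; $d_H(v)$ is the degree of $v$ in $H$; $\chi$ is the chromatic number. The join $G\vee H$ of (vertex-disjoint) graphs has $V(G\vee H)=V(G)\cup V(H)$ and $E(G\vee H)=E(G)\cup E(H)\cup\{uv\mid u\in V(G),v\in V(H)\}$. For a graph $G=(V,E)$ of order $p$ and size $q$, a bijective total labeling is a bijection $f:V\cup E\to\{1,\dots,p+q\}$; its induced vertex coloring is $f^+_{tn}(u)=\sum_{ux\in E}[f(ux)+f(x)]$, with $f^+_{tn}(u)=0$ if $u$ is isolated. Such an $f$ is a local total neighborhood antimagic labeling of $G$ if $f^+_{tn}(u)\ne f^+_{tn}(v)$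 for every edge $uv\in E$. The number of distinct induced colors is $c_{tn}(f)$, and $f$ is then also called a local total neighborhood antimagic $c_{tn}(f)$-coloring of $G$. The local total neighborhood antimagic chromatic number $\chi_{ltna}(G)$ is the minimum of $c_{tn}(f)$ over all local total neighborhood antimagic labelings $f$ of $G$. It is considered for graphs of order at least 2 without isolated vertices that admit such a labeling; thus an assertion $\chi_{ltna}(G)\le k$ or $\chi_{ltna}(G)=k$ includes the assertion that $G$ admits such a labeling. -}

module Defs where

open import Level using (0ℓ)
open import Data.Bool.Base using (Bool; true; false; T; _∧_; if_then_else_)
open import Data.Bool.Properties using (T?)
open import Data.Fin.Base using (Fin; toℕ; splitAt)
open import Data.Integer.Base as ℤ using (ℤ; +_)
open import Data.List.Base using (length; deduplicate; tabulate)
open import Data.Nat.Base using (ℕ; suc; _+_; _*_; _≤_; _<ᵇ_)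
open import Data.Nat.Properties using (_≟_; +-*-semiring)
open import Data.Product.Base using (Σ; ∃; ∃-syntax; _×_; _,_; proj₁)
open import Data.Sum.Base using (_⊎_; inj₁; inj₂)
open import Data.Sum.Relation.Binary.Pointwise using (_⊎ₛ_)
open import Function.Bundles using (Bijection; _↔_; Inverse)
open import Relation.Binary.Bundles using (Setoid)
open import Relation.Binary.PropositionalEquality
  using (_≡_; _≢_; refl; sym; trans; setoid)
open import Relation.Nullary using (yes; no)

open import Algebra.Properties.Semiring.Sum +-*-semiring public using (sum)

record Graph (n : ℕ) : Set where
  field
    adj       : Fin n → Fin n → Bool
    adj-sym   : ∀ u v → adj u v ≡ adj v u
    adj-irrefl : ∀ u → adj u u ≡ false

  Adj : Fin n → Fin n → Set
  Adj u v = T (adj u v)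

  degree : Fin n → ℕ
  degree v = sum λ x → if adj v x then 1 else 0

  -- Each edge is counted once, at its ordered pair u < v.
  size : ℕ
  size = sum λ u → sum λ v → if (toℕ u <ᵇ toℕ v) ∧ adj u v then 1 else 0

  NoIsolated : Set
  NoIsolated = ∀ u → ∃[ x ] Adj u x

  -- An edge is represented by either of its two orientations; the setoid
  -- equality below identifies them, so that the edges are unordered pairs.
  record Edge : Set where
    constructor edge
    field
      {src tgt} : Fin n
      joined    : Adj src tgt

  open Edge public

  SameEnds : Edge → Edge → Set
  SameEnds e e′ = (src e ≡ src e′ × tgt e ≡ tgt e′)
                ⊎ (src e ≡ tgt e′ × tgt e ≡ src e′)

  edgeSetoid : Setoid 0ℓ 0ℓ
  edgeSetoid = record
    { Carrier       = Edge
    ; _≈_           = SameEnds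
    ; isEquivalence = record
      { refl  = inj₁ (refl , refl)
      ; sym   = λ { (inj₁ (a , b)) → inj₁ (sym a , sym b)
                  ; (inj₂ (a , b)) → inj₂ (sym b , sym a) }
      ; trans = λ { (inj₁ (a , b)) (inj₁ (c , d)) → inj₁ (trans a c , trans b d)
                  ; (inj₁ (a , b)) (inj₂ (c , d)) → inj₂ (trans a c , trans b d)
                  ; (inj₂ (a , b)) (inj₁ (c , d)) → inj₂ (trans a d , trans b c)
                  ; (inj₂ (a , b)) (inj₂ (c , d)) → inj₁ (trans a d , trans b c) }
      }
    }

open Graph public using (Adj; degree; size; NoIsolated; edge)

-- The vertices of G come first in Fin (p + m), followed by those of H.
_∨ᴳ_ : ∀ {p m} → Graph p → Graph m → Graph (p + m)
_∨ᴳ_ {p} {m} G H = record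
  { adj        = λ x y → adj′ (splitAt p x) (splitAt p y)
  ; adj-sym    = λ x y → sym′ (splitAt p x) (splitAt p y)
  ; adj-irrefl = λ x → irr′ (splitAt p x)
  }
  where
  adj′ : Fin p ⊎ Fin m → Fin p ⊎ Fin m → Bool
  adj′ (inj₁ u) (inj₁ v) = Graph.adj G u v
  adj′ (inj₂ u) (inj₂ v) = Graph.adj H u v
  adj′ (inj₁ _) (inj₂ _) = true
  adj′ (inj₂ _) (inj₁ _) = true

  sym′ : ∀ x y → adj′ x y ≡ adj′ y x
  sym′ (inj₁ u) (inj₁ v) = Graph.adj-sym G u v
  sym′ (inj₂ u) (inj₂ v) = Graph.adj-sym H u v
  sym′ (inj₁ _) (inj₂ _) = refl
  sym′ (inj₂ _) (inj₁ _) = refl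

  irr′ : ∀ x → adj′ x x ≡ false
  irr′ (inj₁ u) = Graph.adj-irrefl G u
  irr′ (inj₂ u) = Graph.adj-irrefl H u

IsMinimum : (ℕ → Set) → ℕ → Set
IsMinimum P k = P k × (∀ j → P j → k ≤ j)

Proper : ∀ {n k} → Graph n → (Fin n → Fin k) → Set
Proper G c = ∀ u v → Adj G u v → c u ≢ c v

IsChromaticNumber : ∀ {n} → Graph n → ℕ → Set
IsChromaticNumber {n} G = IsMinimum λ k → Σ (Fin n → Fin k) (Proper G)

-- The index x : Fin (n + size G) stands for the label suc (toℕ x), so the
-- labels range over 1, …, n + size G.
TotalLabeling : ∀ {n} → Graph n → Set
TotalLabeling {n} G =
  Bijection (setoid (Fin n) ⊎ₛ Graph.edgeSetoid G) (setoid (Fin (n + size G)))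

module _ {n} {G : Graph n} (f : TotalLabeling G) where

  vertexLabel : Fin n → ℕ
  vertexLabel u = suc (toℕ (Bijection.to f (inj₁ u)))

  edgeLabel : Graph.Edge G → ℕ
  edgeLabel e = suc (toℕ (Bijection.to f (inj₂ e)))

  contribution : Fin n → Fin n → ℕ
  contribution u x with T? (Graph.adj G u x)
  ... | yes ux = edgeLabel (edge ux) + vertexLabel x
  ... | no  _  = 0

  inducedColor : Fin n → ℕ
  inducedColor u = sum (contribution u)

  IsLTNA : Set
  IsLTNA = ∀ u v → Adj G u v → inducedColor u ≢ inducedColor v

  numColors : ℕ
  numColors = length (deduplicate _≟_ (tabulate inducedColor))

LTNAColoring : ∀ {n} → Graph n → ℕ → Set
LTNAColoring G k = Σ (TotalLabeling G) λ f → IsLTNA f × numColors f ≡ k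

-- χ_ltna G = k.  The first two components are the domain on which the
-- invariant is defined; the existence of a labeling is part of the third.
χltna_≈_ : ∀ {n} → Graph n → ℕ → Set
χltna_≈_ {n} G k = 2 ≤ n × NoIsolated G × IsMinimum (LTNAColoring G) k

χltna_≲_ : ∀ {n} → Graph n → ℕ → Set
χltna G ≲ k = ∃[ j ] (χltna G ≈ j) × j ≤ k

Fibre : ∀ {n t} → (Fin n → Fin t) → Fin t → Set
Fibre c l = ∃[ i ] c i ≡ l

record IsPartite {n} (G : Graph n) (t : ℕ) (s : Fin t → ℕ)
                 (part : Fin n → Fin t) : Set where
  field
    independent : Proper G part
    cardinality : ∀ l → Fin (s l) ↔ Fibre part l

-- The values x i with c i ≡ l, listed in some order, are the s terms
-- a, a + d, …, a + (s - 1) d.  For s ≡ 1 this says that a is the only value,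
-- and d plays no role.
ArithmeticOn : ∀ {n t} → (Fin n → ℕ) → (Fin n → Fin t) → Fin t →
               (s a : ℕ) → ℤ → Set
ArithmeticOn x c l s a d =
  Σ (Fin s ↔ Fibre c l) λ e →
    ∀ k → + x (proj₁ (Inverse.to e k)) ≡ + a ℤ.+ + toℕ k ℤ.* d

HasEntries[1,_] : ∀ {p m} → ℕ → (Fin p → Fin m → ℕ) → Set
HasEntries[1, N ] A = (∀ i j → 1 ≤ A i j × A i j ≤ N)
                    × (∀ k → 1 ≤ k → k ≤ N → ∃[ i ] ∃[ j ] A i j ≡ k)

{-# OPTIONS --safe #-}
-- Keep g on G, give the cross edges p + q plus the entries of the matrix with
-- its rows permuted, and shift h by p + q + pm on H.  Opposite common
-- differences make the permuted row sums cancel the progressions on each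
-- partite set, so G receives t colours; the column sums are constant, so a
-- colour class of h stays a colour class.  Conversely every such labeling of the
-- join induces a proper colouring, with disjoint colour sets on G and on H.
-- Constructively, the minimum defining χ_ltna exists because the finitely many
-- labelings can be searched exhaustively.
module Submission where

open import Defs
open import Data.Nat using (ℕ; suc; _+_; _*_; _/_; _≤_)
open import Data.Nat.Divisibility using (_∣_; _∤_)
open import Data.Integer as ℤ using (ℤ; +_)
open import Data.Fin as Fin using (Fin; toℕ)
open import Data.Product using (_×_)
open import Relation.Binary.PropositionalEquality using (_≡_; _≢_)

open import Data.Nat.Properties as ℕₚ
  using (_≟_; ≤-refl; ≤-trans; ≤-antisym; <⇒≤; ≮⇒≥; anyUpTo?; +-assoc; *-identityʳ)
open import Algebra.Properties.Semiring.Sum ℕₚ.+-*-semiring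
  using (sum-cong-≗; ∑-distrib-+; *-distribʳ-sum; sum-permute)
open import Data.Bool.Base using (Bool; true; false; T; if_then_else_; _∧_)
open import Data.Bool.Properties using (T?; T-irrelevant)
open import Data.Fin using (zero; suc; _↑ˡ_; _↑ʳ_; splitAt; join; cast; fromℕ<; combine; remQuot;
                            finToFun; funToFin)
open import Data.Fin.Permutation using (Permutation; _⟨$⟩ʳ_; _⟨$⟩ˡ_; inverseʳ)
open import Data.Fin.Properties as Finₚ
  using (any?; all?; injective⇒≤; finToFun-funToFin; join-splitAt; splitAt-join; toℕ-↑ˡ; toℕ-↑ʳ;
         toℕ-cast; toℕ-injective; toℕ-fromℕ<; toℕ<n; remQuot-combine; <-cmp)
import Data.Integer.Properties as ℤₚ
import Data.Integer.Tactic.RingSolver as ℤSolver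
open import Data.List.Base using (List; length; deduplicate; tabulate; lookup)
open import Data.List.Membership.Propositional.Properties
  using (∈-deduplicate⁺; ∈-deduplicate⁻; ∈-tabulate⁺; ∈-tabulate⁻; ∈-lookup)
open import Data.List.Relation.Unary.All as All using ()
open import Data.List.Relation.Unary.AllPairs using (_∷_)
open import Data.List.Relation.Unary.Any as Any using ()
open import Data.List.Relation.Unary.Any.Properties using (lookup-index)
open import Data.List.Relation.Unary.Unique.DecPropositional.Properties using (deduplicate-!)
open import Data.List.Relation.Unary.Unique.Propositional using (Unique)
open import Data.Nat using (zero; _<_; _<ᵇ_; pred; s≤s; z≤n)
open import Data.Nat.Induction using (<-rec)
open import Data.Nat.Tactic.RingSolver using (solve-∀)
open import Data.Product using (Σ; ∃; ∃-syntax; _,_; proj₁; proj₂; uncurry; map₂)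
open import Data.Sum as Sum using (_⊎_; inj₁; inj₂; [_,_]′)
open import Data.Sum.Properties using (inj₁-injective; inj₂-injective)
open import Data.Sum.Relation.Binary.Pointwise as Pointwise using (_⊎ₛ_)
open import Data.Unit.Base using (tt)
open import Function.Base using (_∘_)
open import Function.Bundles using (Bijection; Inverse; _↔_; mk↔ₛ′)
open import Relation.Binary.Bundles using (Setoid)
open import Relation.Binary.Definitions using (tri<; tri≈; tri>)
open import Relation.Binary.PropositionalEquality
  using (_≗_; refl; sym; trans; cong; cong₂; subst; setoid; module ≡-Reasoning)
open import Relation.Nullary using (Dec; yes; no; ¬_)
open import Relation.Nullary.Decidable using (_×-dec_; _⊎-dec_; _→-dec_; ¬?; map′)
open import Relation.Nullary.Negation using (contradiction)

-- The cross edges and the labels of H change every colour on G by the same amount apart from the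
-- row sum, so condition (i) is all that separates the partite sets. On H the change is not uniform:
-- each neighbour inside H is shifted by p + q + pm, and so is the edge leading to it, so a vertex
-- gains 2(p + q + pm) times its degree. A colour class of `h` may therefore split, and two classes
-- may merge. Condition (iii) makes degrees constant on each class, which prevents splitting;
-- condition (iv) says exactly that no two classes merge. Condition (ii) keeps the colours on the
-- two sides apart, as adjacency across the join demands. The row permutation is harmless for H
-- because it only reorders the terms of each column sum.

-- Pigeonhole, least witnesses and counting distinct colours.

Unique⇒lookup-injective : {A : Set} {xs : List A} → Unique xs →
                          ∀ i j → lookup xs i ≡ lookup xs j → i ≡ j
Unique⇒lookup-injective (_  ∷ _)   zero    zero    _  = refl
Unique⇒lookup-injective (x∉ ∷ _)   zero    (suc j) eq = contradiction eq (All.lookup x∉ (∈-lookup j))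
Unique⇒lookup-injective (x∉ ∷ _)   (suc i) zero    eq = contradiction (sym eq) (All.lookup x∉ (∈-lookup i))
Unique⇒lookup-injective (_  ∷ xs!) (suc i) (suc j) eq = cong suc (Unique⇒lookup-injective xs! i j eq)

-- A missed `y` could be punched out of the codomain, leaving an injection from `Fin (suc n)` into
-- `Fin n`.
injective⇒surjective : ∀ {n} (f : Fin n → Fin n) → (∀ {i j} → f i ≡ f j → i ≡ j) →
                       ∀ y → ∃[ x ] f x ≡ y
injective⇒surjective {suc n} f f-inj y with any? (λ x → f x Finₚ.≟ y)
... | yes hit = hit
... | no miss = contradiction (injective⇒≤ avoid-injective) ℕₚ.1+n≰n
  where
  y≢f : ∀ x → y ≢ f x
  y≢f x eq = miss (x , sym eq)

  avoid-injective : ∀ {i j} → Fin.punchOut (y≢f i) ≡ Fin.punchOut (y≢f j) → i ≡ j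
  avoid-injective = f-inj ∘ Finₚ.punchOut-injective (y≢f _) (y≢f _)

least : {P : ℕ → Set} → (∀ k → Dec (P k)) → ∀ k → P k → ∃[ j ] IsMinimum P j × j ≤ k
least {P} P? = <-rec _ step
  where
  step : ∀ k → (∀ {i} → i < k → P i → ∃[ j ] IsMinimum P j × j ≤ i) →
         P k → ∃[ j ] IsMinimum P j × j ≤ k
  step k rec Pk with anyUpTo? P? k
  ... | yes (i , i<k , Pi) =
    let j , min , j≤i = rec i<k Pi in j , min , ≤-trans j≤i (<⇒≤ i<k)
  ... | no none = k , (Pk , λ j Pj → ≮⇒≥ λ j<k → none (j , j<k , Pj)) , ≤-refl

module _ {n} (c : Fin n → ℕ) where

  colours : List ℕ
  colours = deduplicate _≟_ (tabulate c)

  colourCount : ℕ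
  colourCount = length colours

  colourIndex : Fin n → Fin colourCount
  colourIndex u = Any.index (∈-deduplicate⁺ _≟_ (∈-tabulate⁺ {f = c} u))

  lookup-colourIndex : ∀ u → lookup colours (colourIndex u) ≡ c u
  lookup-colourIndex u = sym (lookup-index (∈-deduplicate⁺ _≟_ (∈-tabulate⁺ {f = c} u)))

  colourIndex-injective : ∀ {u v} → colourIndex u ≡ colourIndex v → c u ≡ c v
  colourIndex-injective {u} {v} eq =
    trans (sym (lookup-colourIndex u)) (trans (cong (lookup colours) eq) (lookup-colourIndex v))

  private
    preimage : ∀ i → ∃[ u ] lookup colours i ≡ c u
    preimage i = ∈-tabulate⁻ (∈-deduplicate⁻ _≟_ (tabulate c) (∈-lookup i))

  representative : Fin colourCount → Fin n
  representative = proj₁ ∘ preimage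

  representative-injective : ∀ {i j} → c (representative i) ≡ c (representative j) → i ≡ j
  representative-injective {i} {j} eq =
    Unique⇒lookup-injective (deduplicate-! _≟_ (tabulate c)) i j
      (trans (proj₂ (preimage i)) (trans eq (sym (proj₂ (preimage j)))))

  -- Pick one vertex per colour: `φ` is injective on these representatives, since a coincidence
  -- under `φ` would force a coincidence of colours.
  colourCount≤ : ∀ {k} (φ : Fin n → Fin k) → (∀ {u v} → φ u ≡ φ v → c u ≡ c v) → colourCount ≤ k
  colourCount≤ φ φ⇒c = injective⇒≤ (representative-injective ∘ φ⇒c)

colourCount-cong : ∀ {n} {c c′ : Fin n → ℕ} → c ≗ c′ → colourCount c ≡ colourCount c′
colourCount-cong {c = c} {c′} eq = ≤-antisym
  (colourCount≤ c  (colourIndex c′) λ {u} {v} i → trans (eq u) (trans (colourIndex-injective c′ i) (sym (eq v))))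
  (colourCount≤ c′ (colourIndex c)  λ {u} {v} i → trans (sym (eq u)) (trans (colourIndex-injective c i) (eq v)))

adj⇒≢ : ∀ {n} (G : Graph n) {u v} → Adj G u v → u ≢ v
adj⇒≢ G {u} uu refl = subst T (Graph.adj-irrefl G u) uu

-- The position of a colour in the deduplicated list is itself a proper colouring, so minimality of
-- the chromatic number applies to it.
chromatic≤colourCount : ∀ {n χ} {G : Graph n} → IsChromaticNumber G χ → (c : Fin n → ℕ) →
                        (∀ u v → Adj G u v → c u ≢ c v) → χ ≤ colourCount c
chromatic≤colourCount (_ , minimal) c proper =
  minimal (colourCount c) (colourIndex c , λ u v uv → proper u v uv ∘ colourIndex-injective c)

-- Evaluating induced colours.

module _ {n} {G : Graph n} (f : TotalLabeling G) where

  open Graph G using (adj)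

  -- `contribution` uses the adjacency proof returned by `T?`; uniqueness of proofs of `T` lets any
  -- other proof take its place.
  contribution-adj : ∀ {u x} (ux : Adj G u x) →
                     contribution f u x ≡ edgeLabel f (edge ux) + vertexLabel f x
  contribution-adj {u} {x} ux with T? (adj u x)
  ... | yes ux′ = cong (λ e → edgeLabel f (edge e) + vertexLabel f x) (T-irrelevant ux′ ux)
  ... | no ¬ux  = contradiction ux ¬ux

  contribution-¬adj : ∀ {u x} → ¬ Adj G u x → contribution f u x ≡ 0
  contribution-¬adj {u} {x} ¬ux with T? (adj u x)
  ... | yes ux = contradiction ux ¬ux
  ... | no _   = refl

-- The proofs stored in a labeling never enter its colours. In the search below this allows one
-- decoded labeling to stand for all labelings with the same underlying map.
inducedColor-cong : ∀ {n} {G : Graph n} {f f′ : TotalLabeling G} →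
                    Bijection.to f ≗ Bijection.to f′ → inducedColor f ≗ inducedColor f′
inducedColor-cong {G = G} {f} {f′} eq u = sum-cong-≗ same
  where
  same : ∀ x → contribution f u x ≡ contribution f′ u x
  same x with T? (Graph.adj G u x)
  ... | yes ux = cong₂ _+_ (cong (suc ∘ toℕ) (eq (inj₂ (edge ux)))) (cong (suc ∘ toℕ) (eq (inj₁ x)))
  ... | no _   = refl

-- Deciding whether a graph has a labeling with a given number of colours.

-- Functions between finite sets are coded by numbers, which can be searched. Decoding returns the
-- original function only pointwise, hence the demand that `P` respect `≗`.
anyFunction? : ∀ {m N} {P : (Fin m → Fin N) → Set} →
               (∀ {a b} → a ≗ b → P a → P b) → (∀ a → Dec (P a)) → Dec (∃ P)
anyFunction? resp P? = map′
  (λ (k , Pk) → finToFun k , Pk)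
  (λ (a , Pa) → funToFin a , resp (λ i → sym (finToFun-funToFin a i)) Pa)
  (any? (λ k → P? (finToFun k)))

any₂Function? : ∀ {m n N} {P : (Fin m → Fin n → Fin N) → Set} →
                (∀ {a b} → (∀ i → a i ≗ b i) → P a → P b) → (∀ a → Dec (P a)) → Dec (∃ P)
any₂Function? resp P? = map′
  (λ (k , Pk) → finToFun ∘ k , Pk)
  (λ (a , Pa) → funToFin ∘ a , resp (λ i j → sym (finToFun-funToFin (a i) j)) Pa)
  -- Each row of the array is first coded as a single number, leaving a search over functions of one
  -- argument.
  (anyFunction? (λ a≗b → resp (λ i j → cong (λ k → finToFun k j) (a≗b i))) (λ k → P? (finToFun ∘ k)))

-- A total labeling is coded by a square array: the label of the vertex u sits
-- on the diagonal at (u , u), which no edge occupies, and the label of the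
-- edge uv at both (u , v) and (v , u); the other entries are irrelevant.
module _ {n} (G : Graph n) where

  open Graph G using (adj; adj-sym; src; tgt; joined)

  private
    N = n + size G

    Array = Fin n → Fin n → Fin N

    Used : Fin n → Fin n → Set
    Used u v = u ≡ v ⊎ Adj G u v

    -- Equality of unordered pairs, with a vertex counted as the degenerate pair (u, u). Injectivity
    -- on vertices, on edges and between the two then becomes a single decidable condition.
    SamePair : (u v w x : Fin n) → Set
    SamePair u v w x = (u ≡ w × v ≡ x) ⊎ (u ≡ x × v ≡ w)

    used? : ∀ u v → Dec (Used u v)
    used? u v = u Finₚ.≟ v ⊎-dec T? (adj u v)

    samePair? : ∀ u v w x → Dec (SamePair u v w x)
    samePair? u v w x = (u Finₚ.≟ w ×-dec v Finₚ.≟ x) ⊎-dec (u Finₚ.≟ x ×-dec v Finₚ.≟ w)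

    flip-edge : ∀ {u v} → Adj G u v → Adj G v u
    flip-edge {u} {v} = subst T (adj-sym u v)

    Symmetric : Array → Set
    Symmetric a = ∀ u v → Adj G u v → a u v ≡ a v u

    Injective : Array → Set
    Injective a = ∀ u v w x → Used u v → Used w x → a u v ≡ a w x → SamePair u v w x

    Surjective : Array → Set
    Surjective a = ∀ y → ∃[ u ] ∃[ v ] Used u v × a u v ≡ y

    IsCode : Array → Set
    IsCode a = Symmetric a × Injective a × Surjective a

    isCode? : ∀ a → Dec (IsCode a)
    isCode? a =
      (all? λ u → all? λ v → T? (adj u v) →-dec (a u v Finₚ.≟ a v u)) ×-dec
      (all? λ u → all? λ v → all? λ w → all? λ x →
        used? u v →-dec (used? w x →-dec (a u v Finₚ.≟ a w x →-dec samePair? u v w x))) ×-dec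
      (all? λ y → any? λ u → any? λ v → used? u v ×-dec (a u v Finₚ.≟ y))

    Realises : TotalLabeling G → Array → Set
    Realises f a = ∀ x → Bijection.to f x ≡ [ (λ u → a u u) , (λ e → a (src e) (tgt e)) ]′ x

    decode : ∀ a → IsCode a → Σ (TotalLabeling G) λ f → Realises f a
    decode a (a-sym , a-inj , a-surj) = record
      { to        = to
      ; cong      = to-cong
      ; bijective = to-injective _ _ , λ y → let x , eq = to-surjective y in
                      x , λ z≈x → trans (to-cong z≈x) eq
      } , λ _ → refl
      where
      open import Data.Sum.Relation.Binary.Pointwise using (inj₁; inj₂)
      open Setoid (setoid (Fin n) ⊎ₛ Graph.edgeSetoid G) using (_≈_)

      to : Fin n ⊎ Graph.Edge G → Fin N
      to = [ (λ u → a u u) , (λ e → a (src e) (tgt e)) ]′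

      to-cong : ∀ {x y} → x ≈ y → to x ≡ to y
      to-cong (inj₁ refl)                 = refl
      to-cong (inj₂ (inj₁ (refl , refl))) = refl
      to-cong {x = inj₂ e} (inj₂ (inj₂ (refl , refl))) = a-sym _ _ (joined e)

      to-injective : ∀ x y → to x ≡ to y → x ≈ y
      to-injective (inj₁ u) (inj₁ v) eq with a-inj u u v v (inj₁ refl) (inj₁ refl) eq
      ... | inj₁ (u≡v , _) = inj₁ u≡v
      ... | inj₂ (u≡v , _) = inj₁ u≡v
      -- A vertex sharing its label with an edge would make that edge a loop.
      to-injective (inj₁ u) (inj₂ e) eq with a-inj u u _ _ (inj₁ refl) (inj₂ (joined e)) eq
      ... | inj₁ (refl , refl) = contradiction refl (adj⇒≢ G (joined e))
      ... | inj₂ (refl , refl) = contradiction refl (adj⇒≢ G (joined e))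
      to-injective (inj₂ e) (inj₁ u) eq with a-inj _ _ u u (inj₂ (joined e)) (inj₁ refl) eq
      ... | inj₁ (refl , refl) = contradiction refl (adj⇒≢ G (joined e))
      ... | inj₂ (refl , refl) = contradiction refl (adj⇒≢ G (joined e))
      to-injective (inj₂ e) (inj₂ e′) eq =
        inj₂ (a-inj _ _ _ _ (inj₂ (joined e)) (inj₂ (joined e′)) eq)

      to-surjective : ∀ y → ∃[ x ] to x ≡ y
      to-surjective y with a-surj y
      ... | u , .u , inj₁ refl , eq = inj₁ u , eq
      ... | u , v  , inj₂ uv   , eq = inj₂ (edge uv) , eq

    -- The converse of `decode`: an array that fails the finite test is realised by no labeling, so
    -- rejecting it loses nothing.
    realised⇒code : ∀ {f a} → Realises f a → IsCode a
    realised⇒code {f} {a} real = a-sym , a-inj , a-surj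
      where
      open import Data.Sum.Relation.Binary.Pointwise using (inj₁; inj₂)
      open Bijection f using (to) renaming (cong to to-cong; injective to to-injective)

      a-sym : Symmetric a
      a-sym u v uv = trans (sym (real (inj₂ (edge uv))))
        (trans (to-cong (inj₂ (inj₂ (refl , refl)))) (real (inj₂ (edge (flip-edge uv)))))

      a-inj : Injective a
      a-inj u v w x (inj₁ refl) (inj₁ refl) eq
        with inj₁ u≡w ← to-injective (trans (real (inj₁ u)) (trans eq (sym (real (inj₁ w)))))
        = inj₁ (u≡w , u≡w)
      -- No constructor of the setoid sum relates a vertex to an edge.
      a-inj u v w x (inj₁ refl) (inj₂ wx) eq
        with () ← to-injective (trans (real (inj₁ u)) (trans eq (sym (real (inj₂ (edge wx))))))
      a-inj u v w x (inj₂ uv) (inj₁ refl) eq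
        with () ← to-injective (trans (real (inj₂ (edge uv))) (trans eq (sym (real (inj₁ w)))))
      a-inj u v w x (inj₂ uv) (inj₂ wx) eq
        with inj₂ same ← to-injective (trans (real (inj₂ (edge uv))) (trans eq (sym (real (inj₂ (edge wx))))))
        = same

      a-surj : Surjective a
      a-surj y with Bijection.strictlySurjective f y
      ... | inj₁ u , eq = u , u , inj₁ refl , trans (sym (real (inj₁ u))) eq
      ... | inj₂ e , eq = _ , _ , inj₂ (joined e) , trans (sym (real (inj₂ e))) eq

    code : (f : TotalLabeling G) → Σ Array (Realises f)
    code f = a , λ { (inj₁ u) → sym (diagonal u) ; (inj₂ e) → sym (off-diagonal (joined e)) }
      where
      open Bijection f using (to)

      a : Array
      a u v with T? (adj u v)
      ... | yes uv = to (inj₂ (edge uv))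
      -- This branch supplies the diagonal; at other non-adjacent pairs the value is an arbitrary
      -- filler.
      ... | no _   = to (inj₁ u)

      diagonal : ∀ u → a u u ≡ to (inj₁ u)
      diagonal u with T? (adj u u)
      ... | yes uu = contradiction refl (adj⇒≢ G uu)
      ... | no _   = refl

      off-diagonal : ∀ {u v} (uv : Adj G u v) → a u v ≡ to (inj₂ (edge uv))
      off-diagonal {u} {v} uv with T? (adj u v)
      ... | yes uv′ = cong (λ e → to (inj₂ (edge e))) (T-irrelevant uv′ uv)
      ... | no ¬uv  = contradiction uv ¬uv

    realises-resp : ∀ {f a b} → (∀ u → a u ≗ b u) → Realises f a → Realises f b
    realises-resp a≗b real (inj₁ u) = trans (real (inj₁ u)) (a≗b u u)
    realises-resp a≗b real (inj₂ e) = trans (real (inj₂ e)) (a≗b (src e) (tgt e))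

  -- Labelings consist of functions and proofs and are not enumerated directly. Every labeling
  -- realises some array, so the search runs over arrays, each asked whether a good labeling
  -- realises it.
  LTNAColoring? : ∀ k → Dec (LTNAColoring G k)
  LTNAColoring? k = map′
    (λ (a , f , _ , good) → f , good)
    (λ (f , good) → let a , real = code f in a , f , real , good)
    (any₂Function? (λ a≗b (f , real , good) → f , realises-resp {f = f} a≗b real , good) coded?)
    where
    Good : TotalLabeling G → Set
    Good f = IsLTNA f × numColors f ≡ k

    good? : ∀ f → Dec (Good f)
    good? f = (all? λ u → all? λ v → T? (adj u v) →-dec ¬? (inducedColor f u ≟ inducedColor f v))
              ×-dec numColors f ≟ k

    good-resp : ∀ {f f′} → inducedColor f ≗ inducedColor f′ → Good f → Good f′
    good-resp eq (proper , count) =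
      (λ u v uv same → proper u v uv (trans (eq u) (trans same (sym (eq v))))) ,
      trans (sym (colourCount-cong eq)) count

    coded? : ∀ a → Dec (Σ (TotalLabeling G) λ f → Realises f a × Good f)
    coded? a with isCode? a
    ... | no ¬code = no λ (f , real , _) → ¬code (realised⇒code {f} real)
    ... | yes c with decode a c
    ...   | f₀ , real₀ with good? f₀
    ...     | yes good = yes (f₀ , real₀ , good)
    -- All labelings realising one array agree pointwise and so have the same colours: failure of
    -- `f₀` refutes every other candidate.
    ...     | no ¬good = no λ (f , real , good) → ¬good
      (good-resp {f} {f₀} (inducedColor-cong {f = f} {f₀} λ x → trans (real x) (sym (real₀ x))) good)

-- The join of two graphs: sums, adjacency, size and the chromatic lower bound.

sum-++ : ∀ p {m} (x : Fin (p + m) → ℕ) → sum x ≡ sum (x ∘ (_↑ˡ m)) + sum (x ∘ (p ↑ʳ_))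
sum-++ zero    x = refl
sum-++ (suc p) x = trans (cong (λ z → x zero + z) (sum-++ p (x ∘ suc))) (sym (+-assoc (x zero) _ _))

sum-const : ∀ n c → sum {n} (λ _ → c) ≡ n * c
sum-const zero    c = refl
sum-const (suc n) c = cong (λ z → c + z) (sum-const n c)

sum-+const : ∀ {n} (x : Fin n → ℕ) c → sum (λ i → c + x i) ≡ n * c + sum x
sum-+const {n} x c = trans (∑-distrib-+ (λ _ → c) x) (cong (_+ sum x) (sum-const n c))

module _ {p m} (G : Graph p) (H : Graph m) where

  private J = G ∨ᴳ H

  -- A nameable copy of the adjacency local to `_∨ᴳ_`, which lets later case analyses run on tagged
  -- vertices instead of on `splitAt`.
  adj⊎ : Fin p ⊎ Fin m → Fin p ⊎ Fin m → Bool
  adj⊎ (inj₁ u) (inj₁ v) = Graph.adj G u v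
  adj⊎ (inj₂ u) (inj₂ v) = Graph.adj H u v
  adj⊎ (inj₁ _) (inj₂ _) = true
  adj⊎ (inj₂ _) (inj₁ _) = true

  adj-splitAt : ∀ x y → Graph.adj J x y ≡ adj⊎ (splitAt p x) (splitAt p y)
  adj-splitAt x y with splitAt p x | splitAt p y
  ... | inj₁ _ | inj₁ _ = refl
  ... | inj₁ _ | inj₂ _ = refl
  ... | inj₂ _ | inj₁ _ = refl
  ... | inj₂ _ | inj₂ _ = refl

  adj-join : ∀ a b → Graph.adj J (join p m a) (join p m b) ≡ adj⊎ a b
  adj-join a b = trans (adj-splitAt (join p m a) (join p m b))
    (cong₂ adj⊎ (splitAt-join p m a) (splitAt-join p m b))

  private
    <ᵇ-↑ʳ : ∀ k (i j : ℕ) → (k + i <ᵇ k + j) ≡ (i <ᵇ j)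
    <ᵇ-↑ʳ zero    i j = refl
    <ᵇ-↑ʳ (suc k) i j = <ᵇ-↑ʳ k i j

    toℕ<ᵇ : ∀ {k} (u : Fin k) j → (toℕ u <ᵇ k + j) ≡ true
    toℕ<ᵇ zero    j = refl
    toℕ<ᵇ (suc u) j = toℕ<ᵇ u j

    ≮ᵇtoℕ : ∀ {k} (u : Fin k) j → (k + j <ᵇ toℕ u) ≡ false
    ≮ᵇtoℕ zero    j = refl
    ≮ᵇtoℕ (suc u) j = ≮ᵇtoℕ u j

    indicator : Bool → ℕ
    indicator b = if b then 1 else 0

  -- Edges are counted at increasing pairs and G occupies the smaller indices. The upper right block
  -- of the adjacency matrix thus contributes all `p * m` cross edges and the lower left block none.
  size-∨ : size J ≡ size G + p * m + size H
  size-∨ = begin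
    size J
      ≡⟨ sum-++ p _ ⟩
    sum (λ u → sum λ y → entry (u ↑ˡ m) y) + sum (λ i → sum λ y → entry (p ↑ʳ i) y)
      ≡⟨ cong₂ _+_ (sum-cong-≗ upper) (sum-cong-≗ lower) ⟩
    sum (λ u → sum (λ v → indicator ((toℕ u <ᵇ toℕ v) ∧ Graph.adj G u v)) + m) + size H
      ≡⟨ cong (_+ size H) 
           (∑-distrib-+ (λ u → sum λ v → indicator ((toℕ u <ᵇ toℕ v) ∧ Graph.adj G u v)) (λ _ → m)) ⟩
    size G + sum {p} (λ _ → m) + size H
      ≡⟨ cong (λ z → size G + z + size H) (sum-const p m) ⟩
    size G + p * m + size H ∎
    where
    open ≡-Reasoning
    entry : Fin (p + m) → Fin (p + m) → ℕ
    entry x y = indicator ((toℕ x <ᵇ toℕ y) ∧ Graph.adj J x y)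

    entry≡ : ∀ a b {β} → (toℕ (join p m a) <ᵇ toℕ (join p m b)) ≡ β →
             entry (join p m a) (join p m b) ≡ indicator (β ∧ adj⊎ a b)
    entry≡ a b eq = cong indicator (cong₂ _∧_ eq (adj-join a b))

    upper : ∀ u → sum (entry (u ↑ˡ m)) ≡ sum (λ v → indicator ((toℕ u <ᵇ toℕ v) ∧ Graph.adj G u v)) + m
    upper u = trans (sum-++ p _) (cong₂ _+_
      (sum-cong-≗ λ v → entry≡ (inj₁ u) (inj₁ v) (cong₂ _<ᵇ_ (toℕ-↑ˡ u m) (toℕ-↑ˡ v m)))
      (trans (sum-cong-≗ λ j → entry≡ (inj₁ u) (inj₂ j)
                (trans (cong₂ _<ᵇ_ (toℕ-↑ˡ u m) (toℕ-↑ʳ p j)) (toℕ<ᵇ u (toℕ j))))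
             (trans (sum-const m 1) (*-identityʳ m))))

    lower : ∀ i → sum (entry (p ↑ʳ i)) ≡ sum (λ j → indicator ((toℕ i <ᵇ toℕ j) ∧ Graph.adj H i j))
    lower i = trans (sum-++ p _) (cong₂ _+_
      (trans (sum-cong-≗ λ v → entry≡ (inj₂ i) (inj₁ v)
                (trans (cong₂ _<ᵇ_ (toℕ-↑ʳ p i) (toℕ-↑ˡ v m)) (≮ᵇtoℕ v (toℕ i))))
             (trans (sum-const p 0) (ℕₚ.*-zeroʳ p)))
      (sum-cong-≗ λ j → entry≡ (inj₂ i) (inj₂ j)
         (trans (cong₂ _<ᵇ_ (toℕ-↑ʳ p i) (toℕ-↑ʳ p j)) (<ᵇ-↑ʳ p (toℕ i) (toℕ j)))))

  ↑ˡ-adj : ∀ {u v} → Adj G u v → Adj J (u ↑ˡ m) (v ↑ˡ m)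
  ↑ˡ-adj {u} {v} = subst T (sym (adj-join (inj₁ u) (inj₁ v)))

  ↑ʳ-adj : ∀ {i j} → Adj H i j → Adj J (p ↑ʳ i) (p ↑ʳ j)
  ↑ʳ-adj {i} {j} = subst T (sym (adj-join (inj₂ i) (inj₂ j)))

  cross-adj : ∀ u j → Adj J (u ↑ˡ m) (p ↑ʳ j)
  cross-adj u j = subst T (sym (adj-join (inj₁ u) (inj₂ j))) tt

  -- Colours of representatives of the colour classes on G and on H are all
  -- distinct, since the join makes every vertex of G adjacent to every one of H.
  chromatic-sum≤colourCount : ∀ {χ χ′} → IsChromaticNumber G χ → IsChromaticNumber H χ′ →
    (c : Fin (p + m) → ℕ) → (∀ x y → Adj J x y → c x ≢ c y) → χ + χ′ ≤ colourCount c
  chromatic-sum≤colourCount χG χH c proper = ℕₚ.≤-trans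
    (ℕₚ.+-mono-≤
      (chromatic≤colourCount {G = G} χG cG (λ u v uv → proper _ _ (↑ˡ-adj uv)))
      (chromatic≤colourCount {G = H} χH cH (λ i j ij → proper _ _ (↑ʳ-adj ij))))
    (injective⇒≤ {f = colourIndex c ∘ rep ∘ splitAt a} λ {x} {y} eq →
      trans (sym (join-splitAt a b x))
        (trans (cong (join a b) (rep-injective (splitAt a x) (splitAt a y) (colourIndex-injective c eq)))
               (join-splitAt a b y)))
    where
    cG = c ∘ (_↑ˡ m)
    cH = c ∘ (p ↑ʳ_)
    a = colourCount cG
    b = colourCount cH

    rep : Fin a ⊎ Fin b → Fin (p + m)
    rep = [ (λ i → representative cG i ↑ˡ m) , (λ j → p ↑ʳ representative cH j) ]′

    rep-injective : ∀ s s′ → c (rep s) ≡ c (rep s′) → s ≡ s′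
    rep-injective (inj₁ i) (inj₁ i′) eq = cong inj₁ (representative-injective cG eq)
    rep-injective (inj₂ j) (inj₂ j′) eq = cong inj₂ (representative-injective cH eq)
    rep-injective (inj₁ i) (inj₂ j)  eq = contradiction eq (proper _ _ (cross-adj _ _))
    rep-injective (inj₂ j) (inj₁ i)  eq = contradiction (sym eq) (proper _ _ (cross-adj _ _))

-- The total labeling of the join assembled from `g`, `h` and a numbering `M` of the matrix cells.

module JoinLabeling {p m} (G : Graph p) (H : Graph m)
  (g : TotalLabeling G) (h : TotalLabeling H) (M : (Fin p × Fin m) ↔ Fin (p * m)) where

  private
    J = G ∨ᴳ H
    module g = Bijection g
    module h = Bijection h

    -- The three consecutive label intervals in tagged form: G, cross edges, H. Their disjointness
    -- becomes a clash of constructors, and arithmetic is confined to `position`.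
    Block = Fin (p + size G) ⊎ (Fin (p * m) ⊎ Fin (m + size H))

    blocks≡ : p + size G + (p * m + (m + size H)) ≡ p + m + size J
    blocks≡ = trans (rearrange p (size G) (p * m) m (size H)) (cong (λ z → p + m + z) (sym (size-∨ G H)))
      where
      rearrange : ∀ a b c d e → a + b + (c + (d + e)) ≡ a + d + (b + c + e)
      rearrange = solve-∀

    position : Block → Fin (p + m + size J)
    position s = cast blocks≡ (join (p + size G) _ (Sum.map₂ (join (p * m) _) s))

    block : Fin (p + m + size J) → Block
    block y = Sum.map₂ (splitAt (p * m)) (splitAt (p + size G) (cast (sym blocks≡) y))

    block-position : ∀ s → block (position s) ≡ s
    block-position s
      rewrite Finₚ.cast-involutive (sym blocks≡) blocks≡ (join (p + size G) _ (Sum.map₂ (join (p * m) _) s))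
            | splitAt-join (p + size G) (p * m + (m + size H)) (Sum.map₂ (join (p * m) _) s)
      with s
    ... | inj₁ _ = refl
    ... | inj₂ r = cong inj₂ (splitAt-join (p * m) _ r)

    position-block : ∀ y → position (block y) ≡ y
    position-block y = trans (cong (cast blocks≡) (inner (cast (sym blocks≡) y)))
      (Finₚ.cast-involutive blocks≡ (sym blocks≡) y)
      where
      inner : ∀ z → join (p + size G) _ (Sum.map₂ (join (p * m) (m + size H))
              (Sum.map₂ (splitAt (p * m)) (splitAt (p + size G) z))) ≡ z
      inner z with splitAt (p + size G) z | join-splitAt (p + size G) _ z
      ... | inj₁ _ | eq = eq
      ... | inj₂ r | eq = trans (cong (p + size G ↑ʳ_) (join-splitAt (p * m) _ r)) eq

    position-injective : ∀ {s s′} → position s ≡ position s′ → s ≡ s′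
    position-injective eq = trans (sym (block-position _)) (trans (cong block eq) (block-position _))

    vertexBlock : Fin p ⊎ Fin m → Block
    vertexBlock (inj₁ u) = inj₁ (g.to (inj₁ u))
    vertexBlock (inj₂ j) = inj₂ (inj₂ (h.to (inj₁ j)))

    edgeBlock : ∀ s s′ → T (adj⊎ G H s s′) → Block
    edgeBlock (inj₁ u) (inj₁ v) uv = inj₁ (g.to (inj₂ (edge uv)))
    edgeBlock (inj₁ u) (inj₂ j) _  = inj₂ (inj₁ (Inverse.to M (u , j)))
    edgeBlock (inj₂ j) (inj₁ u) _  = inj₂ (inj₁ (Inverse.to M (u , j)))
    edgeBlock (inj₂ i) (inj₂ j) ij = inj₂ (inj₂ (h.to (inj₂ (edge ij))))

    -- Splitting the ends of an edge transports its adjacency proof; as such proofs are unique, the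
    -- label does not notice.
    edgeBlock-cong : ∀ {s₁ s₂ s₁′ s₂′} e e′ → s₁ ≡ s₁′ → s₂ ≡ s₂′ → edgeBlock s₁ s₂ e ≡ edgeBlock s₁′ s₂′ e′
    edgeBlock-cong e e′ refl refl = cong (edgeBlock _ _) (T-irrelevant e e′)

    edgeBlock-sym : ∀ s s′ e e′ → edgeBlock s s′ e ≡ edgeBlock s′ s e′
    edgeBlock-sym (inj₁ _) (inj₁ _) _ _ = cong inj₁ (g.cong (Pointwise.inj₂ (inj₂ (refl , refl))))
    edgeBlock-sym (inj₁ _) (inj₂ _) _ _ = refl
    edgeBlock-sym (inj₂ _) (inj₁ _) _ _ = refl
    edgeBlock-sym (inj₂ _) (inj₂ _) _ _ = cong (inj₂ ∘ inj₂) (h.cong (Pointwise.inj₂ (inj₂ (refl , refl))))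

    module _ where
      open import Data.Sum.Relation.Binary.Pointwise using (inj₁; inj₂)

      vertexBlock-injective : ∀ s s′ → vertexBlock s ≡ vertexBlock s′ → s ≡ s′
      vertexBlock-injective (inj₁ u) (inj₁ v) eq
        with inj₁ refl ← g.injective (inj₁-injective eq) = refl
      vertexBlock-injective (inj₂ i) (inj₂ j) eq
        with inj₁ refl ← h.injective (inj₂-injective (inj₂-injective eq)) = refl
      vertexBlock-injective (inj₁ u) (inj₂ j) ()
      vertexBlock-injective (inj₂ i) (inj₁ v) ()

      vertexBlock≢edgeBlock : ∀ s s₁ s₂ e → vertexBlock s ≢ edgeBlock s₁ s₂ e
      vertexBlock≢edgeBlock (inj₁ u) (inj₁ _) (inj₁ _) e eq with () ← g.injective (inj₁-injective eq)
      vertexBlock≢edgeBlock (inj₂ i) (inj₂ _) (inj₂ _) e eq with () ← h.injective (inj₂-injective (inj₂-injective eq))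
      vertexBlock≢edgeBlock (inj₁ u) (inj₁ _) (inj₂ _) e ()
      vertexBlock≢edgeBlock (inj₁ u) (inj₂ _) (inj₁ _) e ()
      vertexBlock≢edgeBlock (inj₁ u) (inj₂ _) (inj₂ _) e ()
      vertexBlock≢edgeBlock (inj₂ i) (inj₁ _) (inj₁ _) e ()
      vertexBlock≢edgeBlock (inj₂ i) (inj₁ _) (inj₂ _) e ()
      vertexBlock≢edgeBlock (inj₂ i) (inj₂ _) (inj₁ _) e ()

      M-injective : ∀ {u i v j} → Inverse.to M (u , i) ≡ Inverse.to M (v , j) → u ≡ v × i ≡ j
      M-injective {u} {i} {v} {j} eq
        with refl ← trans (sym (Inverse.strictlyInverseʳ M (u , i)))
                      (trans (cong (Inverse.from M) eq) (Inverse.strictlyInverseʳ M (v , j))) = refl , refl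

      -- Equal blocks have equal tags, so both edges lie in G, both in H, or both cross. A cross
      -- edge may be given in either orientation, which accounts for the four cases using `M`.
      edgeBlock-injective : ∀ s₁ s₂ s₁′ s₂′ e e′ → edgeBlock s₁ s₂ e ≡ edgeBlock s₁′ s₂′ e′ →
                            (s₁ ≡ s₁′ × s₂ ≡ s₂′) ⊎ (s₁ ≡ s₂′ × s₂ ≡ s₁′)
      edgeBlock-injective (inj₁ _) (inj₁ _) (inj₁ _) (inj₁ _) e e′ eq with g.injective (inj₁-injective eq)
      ... | inj₂ (inj₁ (refl , refl)) = inj₁ (refl , refl)
      ... | inj₂ (inj₂ (refl , refl)) = inj₂ (refl , refl)
      edgeBlock-injective (inj₂ _) (inj₂ _) (inj₂ _) (inj₂ _) e e′ eq with h.injective (inj₂-injective (inj₂-injective eq))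
      ... | inj₂ (inj₁ (refl , refl)) = inj₁ (refl , refl)
      ... | inj₂ (inj₂ (refl , refl)) = inj₂ (refl , refl)
      edgeBlock-injective (inj₁ _) (inj₂ _) (inj₁ _) (inj₂ _) e e′ eq
        with refl , refl ← M-injective (inj₁-injective (inj₂-injective eq)) = inj₁ (refl , refl)
      edgeBlock-injective (inj₁ _) (inj₂ _) (inj₂ _) (inj₁ _) e e′ eq
        with refl , refl ← M-injective (inj₁-injective (inj₂-injective eq)) = inj₂ (refl , refl)
      edgeBlock-injective (inj₂ _) (inj₁ _) (inj₁ _) (inj₂ _) e e′ eq
        with refl , refl ← M-injective (inj₁-injective (inj₂-injective eq)) = inj₂ (refl , refl)
      edgeBlock-injective (inj₂ _) (inj₁ _) (inj₂ _) (inj₁ _) e e′ eq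
        with refl , refl ← M-injective (inj₁-injective (inj₂-injective eq)) = inj₁ (refl , refl)
      edgeBlock-injective (inj₁ _) (inj₁ _) (inj₁ _) (inj₂ _) e e′ ()
      edgeBlock-injective (inj₁ _) (inj₁ _) (inj₂ _) (inj₁ _) e e′ ()
      edgeBlock-injective (inj₁ _) (inj₁ _) (inj₂ _) (inj₂ _) e e′ ()
      edgeBlock-injective (inj₂ _) (inj₂ _) (inj₁ _) (inj₂ _) e e′ ()
      edgeBlock-injective (inj₂ _) (inj₂ _) (inj₂ _) (inj₁ _) e e′ ()
      edgeBlock-injective (inj₂ _) (inj₂ _) (inj₁ _) (inj₁ _) e e′ ()
      edgeBlock-injective (inj₁ _) (inj₂ _) (inj₁ _) (inj₁ _) e e′ ()
      edgeBlock-injective (inj₁ _) (inj₂ _) (inj₂ _) (inj₂ _) e e′ ()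
      edgeBlock-injective (inj₂ _) (inj₁ _) (inj₁ _) (inj₁ _) e e′ ()
      edgeBlock-injective (inj₂ _) (inj₁ _) (inj₂ _) (inj₂ _) e e′ ()

    Source : Set
    Source = Fin (p + m) ⊎ Graph.Edge J

    splitEdge : ∀ x y → Adj J x y → T (adj⊎ G H (splitAt p x) (splitAt p y))
    splitEdge x y = subst T (adj-splitAt G H x y)

    sourceBlock : Source → Block
    sourceBlock (inj₁ x)                = vertexBlock (splitAt p x)
    sourceBlock (inj₂ (edge {x} {y} e)) = edgeBlock (splitAt p x) (splitAt p y) (splitEdge x y e)

    vertexBlock-join : ∀ s → sourceBlock (inj₁ (join p m s)) ≡ vertexBlock s
    vertexBlock-join s = cong vertexBlock (splitAt-join p m s)

    edgeBlock-join : ∀ s s′ e (e⊎ : T (adj⊎ G H s s′)) →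
                     sourceBlock (inj₂ (edge {src = join p m s} {join p m s′} e)) ≡ edgeBlock s s′ e⊎
    edgeBlock-join s s′ e e⊎ = edgeBlock-cong (splitEdge (join p m s) (join p m s′) e) e⊎
      (splitAt-join p m s) (splitAt-join p m s′)

    splitAt-injective : ∀ {x y : Fin (p + m)} → splitAt p x ≡ splitAt p y → x ≡ y
    splitAt-injective {x} {y} eq = trans (sym (join-splitAt p m x))
      (trans (cong (join p m) eq) (join-splitAt p m y))

    sourceBlock-surjective : ∀ b → ∃[ x ] sourceBlock x ≡ b
    sourceBlock-surjective = fromSum
      where
      edgeAt : ∀ s s′ (e : T (adj⊎ G H s s′)) → ∃[ x ] sourceBlock x ≡ edgeBlock s s′ e
      edgeAt s s′ e = inj₂ (edge (subst T (sym (adj-join G H s s′)) e)) , edgeBlock-join s s′ _ e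

      fromSum : ∀ b → ∃[ x ] sourceBlock x ≡ b
      fromSum (inj₁ k) with g.strictlySurjective k
      ... | inj₁ u         , refl = inj₁ (join p m (inj₁ u)) , vertexBlock-join (inj₁ u)
      ... | inj₂ (edge uv) , refl = edgeAt (inj₁ _) (inj₁ _) uv
      fromSum (inj₂ (inj₁ k)) =
        map₂ (λ eq → trans eq (cong (inj₂ ∘ inj₁) (Inverse.strictlyInverseˡ M k)))
             (edgeAt (inj₁ (proj₁ (Inverse.from M k))) (inj₂ (proj₂ (Inverse.from M k))) tt)
      fromSum (inj₂ (inj₂ k)) with h.strictlySurjective k
      ... | inj₁ j         , refl = inj₁ (join p m (inj₂ j)) , vertexBlock-join (inj₂ j)
      ... | inj₂ (edge ij) , refl = edgeAt (inj₂ _) (inj₂ _) ij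

  joinLabeling : TotalLabeling J
  joinLabeling = record
    { to        = position ∘ sourceBlock
    ; cong      = cong position ∘ block-cong
    ; bijective = block-injective _ _ ∘ position-injective
                , λ y → let x , eq = sourceBlock-surjective (block y) in
                    x , λ z≈x → trans (cong position (trans (block-cong z≈x) eq)) (position-block y)
    }
    where
    open import Data.Sum.Relation.Binary.Pointwise using (inj₁; inj₂)
    open Setoid (setoid (Fin (p + m)) ⊎ₛ Graph.edgeSetoid J) using (_≈_)

    block-cong : ∀ {x y} → x ≈ y → sourceBlock x ≡ sourceBlock y
    block-cong (inj₁ refl) = refl
    block-cong (inj₂ (inj₁ (refl , refl))) = edgeBlock-cong _ _ refl refl
    block-cong (inj₂ (inj₂ (refl , refl))) = edgeBlock-sym _ _ _ _

    block-injective : ∀ x y → sourceBlock x ≡ sourceBlock y → x ≈ y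
    block-injective (inj₁ x) (inj₁ y) eq = inj₁ (splitAt-injective (vertexBlock-injective _ _ eq))
    block-injective (inj₁ x) (inj₂ e) eq = contradiction eq (vertexBlock≢edgeBlock _ _ _ _)
    block-injective (inj₂ e) (inj₁ x) eq = contradiction (sym eq) (vertexBlock≢edgeBlock _ _ _ _)
    block-injective (inj₂ e) (inj₂ e′) eq with edgeBlock-injective _ _ _ _ _ _ eq
    ... | inj₁ (a , b) = inj₂ (inj₁ (splitAt-injective a , splitAt-injective b))
    ... | inj₂ (a , b) = inj₂ (inj₂ (splitAt-injective a , splitAt-injective b))

  private
    label : Block → ℕ
    label b = suc (toℕ (position b))

    label-G : ∀ k → label (inj₁ k) ≡ suc (toℕ k)
    label-G k = cong suc (trans (toℕ-cast blocks≡ _) (toℕ-↑ˡ k _))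

    label-cross : ∀ k → label (inj₂ (inj₁ k)) ≡ p + size G + suc (toℕ k)
    label-cross k = trans
      (cong suc (trans (toℕ-cast blocks≡ _) (trans (toℕ-↑ʳ (p + size G) _)
        (cong (λ z → p + size G + z) (toℕ-↑ˡ k _)))))
      (sym (ℕₚ.+-suc _ _))

    label-H : ∀ k → label (inj₂ (inj₂ k)) ≡ p + size G + p * m + suc (toℕ k)
    label-H k = trans
      (cong suc (trans (toℕ-cast blocks≡ _) (trans (toℕ-↑ʳ (p + size G) _)
        (cong (λ z → p + size G + z) (toℕ-↑ʳ (p * m) k)))))
      (trans (cong suc (sym (+-assoc (p + size G) _ _))) (sym (ℕₚ.+-suc _ _)))

    f = joinLabeling
    K = p + size G + p * m

    crossLabel : Fin p → Fin m → ℕ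
    crossLabel u j = suc (toℕ (Inverse.to M (u , j)))

    vertexLabel-G : ∀ u → vertexLabel f (u ↑ˡ m) ≡ vertexLabel g u
    vertexLabel-G u = trans (cong label (vertexBlock-join (inj₁ u))) (label-G _)

    vertexLabel-H : ∀ j → vertexLabel f (p ↑ʳ j) ≡ K + vertexLabel h j
    vertexLabel-H j = trans (cong label (vertexBlock-join (inj₂ j))) (label-H _)

    ¬join-adj : ∀ s s′ → ¬ T (adj⊎ G H s s′) → ¬ Adj J (join p m s) (join p m s′)
    ¬join-adj s s′ ¬e e = ¬e (subst T (adj-join G H s s′) e)

    contribution-join : ∀ s s′ (e : T (adj⊎ G H s s′)) →
      contribution f (join p m s) (join p m s′) ≡ label (edgeBlock s s′ e) + vertexLabel f (join p m s′)
    contribution-join s s′ e = trans (contribution-adj f (subst T (sym (adj-join G H s s′)) e))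
      (cong (λ b → label b + vertexLabel f (join p m s′))
        (edgeBlock-join s s′ (subst T (sym (adj-join G H s s′)) e) e))

    contribution-GG : ∀ u v → contribution f (u ↑ˡ m) (v ↑ˡ m) ≡ contribution g u v
    contribution-GG u v with T? (Graph.adj G u v)
    ... | yes uv = trans (contribution-join (inj₁ u) (inj₁ v) uv) (cong₂ _+_ (label-G _) (vertexLabel-G v))
    ... | no ¬uv = contribution-¬adj f (¬join-adj (inj₁ u) (inj₁ v) ¬uv)

    contribution-GH : ∀ u j → contribution f (u ↑ˡ m) (p ↑ʳ j)
                              ≡ (p + size G + crossLabel u j) + (K + vertexLabel h j)
    contribution-GH u j = trans (contribution-join (inj₁ u) (inj₂ j) tt)
      (cong₂ _+_ (label-cross _) (vertexLabel-H j))

    contribution-HG : ∀ j u → contribution f (p ↑ʳ j) (u ↑ˡ m)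
                              ≡ (p + size G + crossLabel u j) + vertexLabel g u
    contribution-HG j u = trans (contribution-join (inj₂ j) (inj₁ u) tt)
      (cong₂ _+_ (label-cross _) (vertexLabel-G u))

    -- `K` enters twice per neighbour, through the edge label and through the vertex label. The
    -- indicator factor is there so that summation over `j` produces the degree.
    contribution-HH : ∀ i j → contribution f (p ↑ʳ i) (p ↑ʳ j)
                              ≡ contribution h i j + (if Graph.adj H i j then 1 else 0) * (2 * K)
    contribution-HH i j with T? (Graph.adj H i j)
    ... | yes ij = trans (contribution-join (inj₂ i) (inj₂ j) ij)
      (trans (cong₂ _+_ (label-H _) (vertexLabel-H j))
      (trans (rearrange K _ _)
        (cong (λ z → edgeLabel h (edge ij) + vertexLabel h j + z * (2 * K)) (sym (if-true ij)))))
      where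
      rearrange : ∀ k a b → (k + a) + (k + b) ≡ a + b + 1 * (2 * k)
      rearrange = solve-∀
      if-true : ∀ {b} → T b → (if b then 1 else 0) ≡ 1
      if-true {true} _ = refl
    ... | no ¬ij = trans (contribution-¬adj f (¬join-adj (inj₂ i) (inj₂ j) ¬ij))
      (cong (_* (2 * K)) (sym (if-false ¬ij)))
      where
      if-false : ∀ {b} → ¬ T b → (if b then 1 else 0) ≡ 0
      if-false {false} _  = refl
      if-false {true}  ¬t = contradiction tt ¬t

  -- Each of the m vertices of H adds the offset p + q of its cross edge and the shift `K` of its
  -- own label, together 2p + 2q + pm.
  inducedColor-G : ∀ u → inducedColor f (u ↑ˡ m) ≡
    inducedColor g u + sum (crossLabel u) + m * (2 * p + 2 * size G + p * m) + sum (vertexLabel h)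
  inducedColor-G u = begin
    inducedColor f (u ↑ˡ m)
      ≡⟨ sum-++ p _ ⟩
    sum (λ v → contribution f (u ↑ˡ m) (v ↑ˡ m)) + sum (λ j → contribution f (u ↑ˡ m) (p ↑ʳ j))
      ≡⟨ cong₂ _+_ (sum-cong-≗ (contribution-GG u)) (sum-cong-≗ (contribution-GH u)) ⟩
    inducedColor g u + sum (λ j → (p + size G + crossLabel u j) + (K + vertexLabel h j))
      ≡⟨ cong (λ z → inducedColor g u + z) (trans
           (∑-distrib-+ (λ j → p + size G + crossLabel u j) (λ j → K + vertexLabel h j))
           (cong₂ _+_ (sum-+const (crossLabel u) (p + size G)) (sum-+const (vertexLabel h) K))) ⟩
    inducedColor g u + ((m * (p + size G) + sum (crossLabel u)) + (m * K + sum (vertexLabel h)))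
      ≡⟨ rearrange (inducedColor g u) (sum (crossLabel u)) (sum (vertexLabel h)) m p (size G) ⟩
    inducedColor g u + sum (crossLabel u) + m * (2 * p + 2 * size G + p * m) + sum (vertexLabel h) ∎
    where
    open ≡-Reasoning
    rearrange : ∀ x r s m p q → x + ((m * (p + q) + r) + (m * (p + q + p * m) + s))
                                ≡ x + r + m * (2 * p + 2 * q + p * m) + s
    rearrange = solve-∀

  -- The vertices of G keep their labels, so the p cross edges add only p + q each; the rest of the
  -- shift is `2 * K` per neighbour in H.
  inducedColor-H : ∀ j → inducedColor f (p ↑ʳ j) ≡
    sum (vertexLabel g) + sum (λ u → crossLabel u j) + p * (p + size G)
      + inducedColor h j + 2 * degree H j * (p + size G + p * m)
  inducedColor-H j = begin
    inducedColor f (p ↑ʳ j)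
      ≡⟨ sum-++ p _ ⟩
    sum (λ u → contribution f (p ↑ʳ j) (u ↑ˡ m)) + sum (λ i → contribution f (p ↑ʳ j) (p ↑ʳ i))
      ≡⟨ cong₂ _+_ (sum-cong-≗ (contribution-HG j)) (sum-cong-≗ (contribution-HH j)) ⟩
    sum (λ u → (p + size G + crossLabel u j) + vertexLabel g u)
      + sum (λ i → contribution h j i + neighbour i * (2 * K))
      ≡⟨ cong₂ _+_
           (trans (∑-distrib-+ (λ u → p + size G + crossLabel u j) (vertexLabel g))
                  (cong (_+ sum (vertexLabel g)) (sum-+const (λ u → crossLabel u j) (p + size G))))
           (trans (∑-distrib-+ (contribution h j) (λ i → neighbour i * (2 * K)))
                  (cong (λ z → inducedColor h j + z) (sym (*-distribʳ-sum (2 * K) neighbour)))) ⟩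
    (p * (p + size G) + sum (λ u → crossLabel u j) + sum (vertexLabel g))
      + (inducedColor h j + degree H j * (2 * K))
      ≡⟨ rearrange (p * (p + size G)) (sum (λ u → crossLabel u j)) (sum (vertexLabel g))
           (inducedColor h j) (degree H j) K ⟩
    sum (vertexLabel g) + sum (λ u → crossLabel u j) + p * (p + size G)
      + inducedColor h j + 2 * degree H j * (p + size G + p * m) ∎
    where
    open ≡-Reasoning
    neighbour : Fin m → ℕ
    neighbour i = if Graph.adj H j i then 1 else 0
    rearrange : ∀ a b c x d k → (a + b + c) + (x + d * (2 * k)) ≡ c + b + a + x + 2 * d * k
    rearrange = solve-∀

-- The matrix as a numbering of its cells, and the matching of opposite progressions.

entryBijection : ∀ {p m} (A : Fin p → Fin m → ℕ) → HasEntries[1, p * m ] A →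
  Σ ((Fin p × Fin m) ↔ Fin (p * m)) λ M → ∀ i j → suc (toℕ (Inverse.to M (i , j))) ≡ A i j
entryBijection {p} {m} A (range , onto) =
  mk↔ₛ′ index cell index-cell cell-index , λ i j → suc-index (i , j)
  where
  suc-pred : ∀ {a} → 1 ≤ a → suc (pred a) ≡ a
  suc-pred (s≤s _) = refl

  index : Fin p × Fin m → Fin (p * m)
  index (i , j) =
    fromℕ< (subst (_≤ p * m) (sym (suc-pred (proj₁ (range i j)))) (proj₂ (range i j)))

  suc-index : ∀ ij → suc (toℕ (index ij)) ≡ uncurry A ij
  suc-index (i , j) = trans (cong suc (toℕ-fromℕ< _)) (suc-pred (proj₁ (range i j)))

  cell : Fin (p * m) → Fin p × Fin m
  cell k = let i , j , _ = onto (suc (toℕ k)) (s≤s z≤n) (toℕ<n k) in i , j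

  index-cell : ∀ k → index (cell k) ≡ k
  index-cell k = toℕ-injective (ℕₚ.suc-injective (trans (suc-index (cell k))
    (proj₂ (proj₂ (onto (suc (toℕ k)) (s≤s z≤n) (toℕ<n k))))))

  combine-injective : ∀ {x y : Fin p × Fin m} → uncurry combine x ≡ uncurry combine y → x ≡ y
  combine-injective {x} {y} eq =
    trans (sym (uncurry remQuot-combine x)) (trans (cong (remQuot m) eq) (uncurry remQuot-combine y))

  cell-injective : ∀ {k k′} → uncurry combine (cell k) ≡ uncurry combine (cell k′) → k ≡ k′
  cell-injective {k} {k′} eq =
    trans (sym (index-cell k)) (trans (cong index (combine-injective eq)) (index-cell k′))

  cell-index : ∀ ij → cell (index ij) ≡ ij
  -- `cell` is only a chosen right inverse of `index`, hence injective. There are as many cells as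
  -- entries, so it is also surjective, and the inverse is two-sided.
  cell-index ij with injective⇒surjective (uncurry combine ∘ cell) cell-injective (uncurry combine ij)
  ... | k , eq with refl ← combine-injective eq = cong cell (index-cell k)

module Transfer {n t} {s : Fin t → ℕ} {c c′ : Fin n → Fin t}
  (e : ∀ l → Fin (s l) ↔ Fibre c l) (e′ : ∀ l → Fin (s l) ↔ Fibre c′ l) where

  rank : ∀ i → Fin (s (c i))
  rank i = Inverse.from (e (c i)) (i , refl)

  to-rank : ∀ i → proj₁ (Inverse.to (e (c i)) (rank i)) ≡ i
  to-rank i = cong proj₁ (Inverse.strictlyInverseˡ (e (c i)) (i , refl))

  transfer : Fin n → Fin n
  transfer i = proj₁ (Inverse.to (e′ (c i)) (rank i))

  -- `transfer` matches the k-th elements of corresponding fibres. Stated for an arbitrary `l`, this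
  -- yields both inverse laws of the permutation by exchanging `e` and `e′`.
  transfer-to : ∀ l k → transfer (proj₁ (Inverse.to (e l) k)) ≡ proj₁ (Inverse.to (e′ l) k)
  transfer-to l k = at (Inverse.to (e l) k) refl
    where
    at : ∀ x → Inverse.to (e l) k ≡ x → transfer (proj₁ x) ≡ proj₁ (Inverse.to (e′ l) k)
    at (i , refl) eq = cong (proj₁ ∘ Inverse.to (e′ l))
      (trans (cong (Inverse.from (e l)) (sym eq)) (Inverse.strictlyInverseʳ (e l) k))

module _ {n t} {s : Fin t → ℕ} {c c′ : Fin n → Fin t}
  (e : ∀ l → Fin (s l) ↔ Fibre c l) (e′ : ∀ l → Fin (s l) ↔ Fibre c′ l) where

  private
    module ⇒ = Transfer e e′
    module ⇐ = Transfer e′ e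

  transferPermutation : Permutation n n
  transferPermutation = mk↔ₛ′ ⇒.transfer ⇐.transfer
    (λ i → trans (⇒.transfer-to _ (⇐.rank i)) (⇐.to-rank i))
    (λ i → trans (⇐.transfer-to _ (⇒.rank i)) (⇒.to-rank i))

-- Elements of equal rank k are paired, and a + kd cancels against b - kd to leave a + b. The
-- computation is done in the integers because d may be negative.
opposite-progressions : ∀ {n t} {c c′ : Fin n → Fin t} {s : Fin t → ℕ} {x y : Fin n → ℕ}
  {a b : Fin t → ℕ} {d : Fin t → ℤ} →
  (∀ l → ArithmeticOn x c l (s l) (a l) (d l)) →
  (∀ l → ArithmeticOn y c′ l (s l) (b l) (ℤ.- d l)) →
  ∃[ π ] (∀ i → x i + y (_⟨$⟩ʳ_ {n} {n} π i) ≡ a (c i) + b (c i))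
opposite-progressions {c = c} {x = x} {y} {a} {b} {d} X Y =
  transferPermutation (proj₁ ∘ X) (proj₁ ∘ Y) , λ i →
  let k = rank i
      l = c i
  in ℤₚ.+-injective (begin
    + (x i + y (transfer i))
      ≡⟨ cong (λ j → + (x j + y (transfer i))) (sym (to-rank i)) ⟩
    + x (proj₁ (Inverse.to (proj₁ (X l)) k)) ℤ.+ + y (transfer i)
      ≡⟨ cong₂ ℤ._+_ (proj₂ (X l) k) (proj₂ (Y l) k) ⟩
    (+ a l ℤ.+ + toℕ k ℤ.* d l) ℤ.+ (+ b l ℤ.+ + toℕ k ℤ.* (ℤ.- d l))
      ≡⟨ rearrange (+ a l) (+ b l) (+ toℕ k) (d l) ⟩
    + (a l + b l) ∎)
  where
  open ≡-Reasoning
  open Transfer (proj₁ ∘ X) (proj₁ ∘ Y)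
  rearrange : ∀ a b k d → (a ℤ.+ k ℤ.* d) ℤ.+ (b ℤ.+ k ℤ.* (ℤ.- d)) ≡ a ℤ.+ b
  rearrange = ℤSolver.solve-∀

-- Rewrites a collision of two shifted colours on H, an equation between naturals, as the integer
-- equation that condition (iv) forbids.
difference-of-offsets : ∀ x y d e k → x + 2 * d * k ≡ y + 2 * e * k →
                        + x ℤ.- + y ≡ + (2 * k) ℤ.* (+ e ℤ.- + d)
difference-of-offsets x y d e k eq = begin
  + x ℤ.- + y
    ≡⟨ expand (+ x) (+ y) (+ d) (+ k) ⟩
  (+ x ℤ.+ + 2 ℤ.* + d ℤ.* + k) ℤ.- (+ 2 ℤ.* + d ℤ.* + k) ℤ.- + y
    ≡⟨ cong (λ z → z ℤ.- (+ 2 ℤ.* + d ℤ.* + k) ℤ.- + y)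
         (trans (sym (embed x d)) (trans (cong +_ eq) (embed y e))) ⟩
  (+ y ℤ.+ + 2 ℤ.* + e ℤ.* + k) ℤ.- (+ 2 ℤ.* + d ℤ.* + k) ℤ.- + y
    ≡⟨ collect (+ y) (+ d) (+ e) (+ k) ⟩
  (+ 2 ℤ.* + k) ℤ.* (+ e ℤ.- + d)
    ≡⟨ cong (ℤ._* (+ e ℤ.- + d)) (sym (ℤₚ.pos-* 2 k)) ⟩
  + (2 * k) ℤ.* (+ e ℤ.- + d) ∎
  where
  open ≡-Reasoning
  embed : ∀ z w → + (z + 2 * w * k) ≡ + z ℤ.+ + 2 ℤ.* + w ℤ.* + k
  embed z w = cong (λ y → + z ℤ.+ y) (trans (ℤₚ.pos-* (2 * w) k) (cong (λ y → y ℤ.* + k) (ℤₚ.pos-* 2 w)))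
  expand : ∀ x y d k → x ℤ.- y ≡ (x ℤ.+ + 2 ℤ.* d ℤ.* k) ℤ.- (+ 2 ℤ.* d ℤ.* k) ℤ.- y
  expand = ℤSolver.solve-∀
  collect : ∀ y d e k → (y ℤ.+ + 2 ℤ.* e ℤ.* k) ℤ.- (+ 2 ℤ.* d ℤ.* k) ℤ.- y ≡ (+ 2 ℤ.* k) ℤ.* (e ℤ.- d)
  collect = ℤSolver.solve-∀

<-distinct⇒distinct : ∀ {t} (x : Fin t → ℕ) →
                      (∀ l l′ → l Fin.< l′ → x l ≢ x l′) → ∀ {l l′} → l ≢ l′ → x l ≢ x l′
<-distinct⇒distinct x <-distinct {l} {l′} l≢l′ eq with <-cmp l l′
... | tri< l<l′ _ _ = <-distinct l l′ l<l′ eq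
... | tri≈ _ l≡l′ _ = l≢l′ l≡l′
... | tri> _ _ l′<l = <-distinct l′ l l′<l (sym eq)

-- Bounds on the invariant of the join, obtained from the colour values alone.

∨-noIsolated : ∀ {p m} (G : Graph p) (H : Graph m) → Fin p → Fin m → NoIsolated (G ∨ᴳ H)
∨-noIsolated {p} {m} G H u₀ j₀ x =
  subst (λ x → ∃[ y ] Adj (G ∨ᴳ H) x y) (join-splitAt p m x)
    (neighbour (splitAt p x))
  where
  neighbour : ∀ s → ∃[ y ] Adj (G ∨ᴳ H) (join p m s) y
  neighbour (inj₁ u) = p ↑ʳ j₀ , cross-adj G H u j₀
  neighbour (inj₂ j) = u₀ ↑ˡ m , subst T (Graph.adj-sym (G ∨ᴳ H) (u₀ ↑ˡ m) (p ↑ʳ j)) (cross-adj G H u₀ j)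

-- A single labeling gives a starting point for the descending search, so the minimum both exists
-- and is bounded by its number of colours.
χltna-attained : ∀ {n} {G : Graph n} {k} → 2 ≤ n → NoIsolated G →
                 (f : TotalLabeling G) → IsLTNA f → numColors f ≤ k → χltna G ≲ k
χltna-attained {G = G} 2≤n no-isolated f f-ltna f≤k =
  let j , j-min , j≤f = least (LTNAColoring? G) (numColors f) (f , f-ltna , refl) in
  j , (2≤n , no-isolated , j-min) , ℕₚ.≤-trans j≤f f≤k

χltna-∨≥ : ∀ {p m χ χ′ k} (G : Graph p) (H : Graph m) → IsChromaticNumber G χ → IsChromaticNumber H χ′ →
           χltna (G ∨ᴳ H) ≈ k → χ + χ′ ≤ k
χltna-∨≥ G H χG χH (_ , _ , (f , f-ltna , count) , _) =
  subst (_ ≤_) count (chromatic-sum≤colourCount G H χG χH (inducedColor f) f-ltna)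

module _ {p m t} (G : Graph p) (H : Graph m) {part : Fin p → Fin t} (part-proper : Proper G part)
  (h : TotalLabeling H) (h-ltna : IsLTNA h)
  (valueG : Fin t → ℕ) (valueG-distinct : ∀ {l l′} → l ≢ l′ → valueG l ≢ valueG l′)
  (valueH : Fin m → ℕ)
  (valueH-cong : ∀ {i j} → inducedColor h i ≡ inducedColor h j → valueH i ≡ valueH j)
  (valueH-distinct : ∀ {i j} → i ≢ j → inducedColor h i ≢ inducedColor h j → valueH i ≢ valueH j)
  (valueG≢valueH : ∀ l j → valueG l ≢ valueH j)
  (f : TotalLabeling (G ∨ᴳ H))
  (colour-G : ∀ u → inducedColor f (u ↑ˡ m) ≡ valueG (part u))
  (colour-H : ∀ j → inducedColor f (p ↑ʳ j) ≡ valueH j) where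

  private
    value : Fin p ⊎ Fin m → ℕ
    value = [ valueG ∘ part , valueH ]′

    colour : ∀ x → inducedColor f x ≡ value (splitAt p x)
    colour x = trans (cong (inducedColor f) (sym (join-splitAt p m x))) (at (splitAt p x))
      where
      at : ∀ a → inducedColor f (join p m a) ≡ value a
      at (inj₁ u) = colour-G u
      at (inj₂ j) = colour-H j

    value-proper : ∀ a b → T (adj⊎ G H a b) → value a ≢ value b
    value-proper (inj₁ u) (inj₁ v) uv    = valueG-distinct (part-proper u v uv)
    value-proper (inj₁ u) (inj₂ j) _  eq = valueG≢valueH (part u) j eq
    value-proper (inj₂ j) (inj₁ u) _  eq = valueG≢valueH (part u) j (sym eq)
    value-proper (inj₂ i) (inj₂ j) ij    = valueH-distinct (adj⇒≢ H ij) (h-ltna i j ij)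

    class : Fin p ⊎ Fin m → Fin t ⊎ Fin (numColors h)
    class = Sum.map part (colourIndex (inducedColor h))

    value-class : ∀ a b → class a ≡ class b → value a ≡ value b
    value-class (inj₁ u) (inj₁ v) eq = cong valueG (inj₁-injective eq)
    value-class (inj₂ i) (inj₂ j) eq =
      valueH-cong (colourIndex-injective (inducedColor h) (inj₂-injective eq))

  join-ltna : IsLTNA f
  join-ltna x y xy eq = value-proper (splitAt p x) (splitAt p y) (subst T (adj-splitAt G H x y) xy)
    (trans (sym (colour x)) (trans eq (colour y)))

  -- The colour is constant on each of the `t` partite sets and on each colour class of `h`, so
  -- these classes bound the number of colours.
  join-numColors : numColors f ≤ t + numColors h
  join-numColors = colourCount≤ (inducedColor f) (join t (numColors h) ∘ class ∘ splitAt p) λ {x} {y} eq →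
    trans (colour x) (trans (value-class (splitAt p x) (splitAt p y) (join-injective eq)) (sym (colour y)))
    where
    join-injective : ∀ {a b} → join t (numColors h) a ≡ join t (numColors h) b → a ≡ b
    join-injective {a} {b} eq = trans (sym (Finₚ.splitAt-join t (numColors h) a))
      (trans (cong (splitAt t) eq) (Finₚ.splitAt-join t (numColors h) b))

-- Conditions (i) to (iv) applied to the matrix with permuted rows.

theorem2p4 : (p q m ν t t′ : ℕ) →
    2 ≤ p → 2 ∣ p → 3 ≤ m → 2 ∤ m →
    (G : Graph p) → size G ≡ q →
    2 ≤ t →
    (s : Fin t → ℕ) →
    (∀ l → 1 ≤ s l) →
    (∀ l l⁺ → toℕ l⁺ ≡ suc (toℕ l) → s l ≤ s l⁺) →
    (part : Fin p → Fin t) → IsPartite G t s part →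
    (α β : Fin t → ℕ) (d : Fin t → ℤ) →
    (g : TotalLabeling G) →
    (∀ l → ArithmeticOn (inducedColor g) part l (s l) (α l) (d l)) →
    (A : Fin p → Fin m → ℕ) →
    HasEntries[1, p * m ] A →
    (∀ j → sum (λ i → A i j) ≡ p * (p * m + 1) / 2) →
    (S : Fin p → Fin t) →
    (∀ l → ArithmeticOn (λ i → sum (A i)) S l (s l) (β l) (ℤ.- d l)) →
    (H : Graph m) → size H ≡ ν →
    2 ≤ t′ → IsChromaticNumber H t′ → χltna H ≈ t′ →
    (h : TotalLabeling H) → IsLTNA h → numColors h ≡ t′ →
    (∀ l l′ → l Fin.< l′ → α l + β l ≢ α l′ + β l′) →
    (∀ l j →
    α l + β l + m * (2 * p + 2 * q + p * m) + sum (vertexLabel h)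
    ≢ sum (vertexLabel g) + p * (p * m + 1) / 2 + p * (p + q)
    + inducedColor h j + 2 * degree H j * (p + q + p * m)) →
    (∀ j j′ → j ≢ j′ → inducedColor h j ≡ inducedColor h j′ →
    degree H j ≡ degree H j′) →
    (∀ j j′ → j ≢ j′ → inducedColor h j ≢ inducedColor h j′ →
    + inducedColor h j ℤ.- + inducedColor h j′
    ≢ + (2 * (p + q + p * m)) ℤ.* (+ degree H j′ ℤ.- + degree H j)) →
    (χltna (G ∨ᴳ H) ≲ (t + t′))
    × (IsChromaticNumber G t → χltna (G ∨ᴳ H) ≈ (t + t′))
theorem2p4 p _ m _ t _ 2≤p _ 3≤m _ G refl _ s _ _ part partite α β d g g-progressions A A-entries A-columns
           S A-progressions H refl _ χH _ h h-ltna refl α+β-distinct G≢H same-degree different-colour =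
  upper , λ χG →
    -- The exact value `k` already comes with the upper bound; the chromatic lower bound forces it
    -- to equal `t + t′`.
    let k , χ≈k , k≤ = upper in
    subst (χltna J ≈_) (ℕₚ.≤-antisym k≤ (χltna-∨≥ G H χG χH χ≈k)) χ≈k
  where
  J = G ∨ᴳ H
  t′ = numColors h
  K = p + size G + p * m

  π-and-sums = opposite-progressions {x = inducedColor g} {y = λ i → sum (A i)} g-progressions A-progressions
  π = proj₁ π-and-sums

  A′ : Fin p → Fin m → ℕ
  A′ u = A (π ⟨$⟩ʳ u)

  A′-entries : HasEntries[1, p * m ] A′
  A′-entries = (λ u → proj₁ A-entries (π ⟨$⟩ʳ u)) , λ v 1≤v v≤pm →
    let i , j , eq = proj₂ A-entries v 1≤v v≤pm in
    π ⟨$⟩ˡ i , j , trans (cong (λ r → A r j) (inverseʳ π)) eq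

  M = proj₁ (entryBijection A′ A′-entries)

  M≡A′ : ∀ u j → suc (toℕ (Inverse.to M (u , j))) ≡ A′ u j
  M≡A′ = proj₂ (entryBijection A′ A′-entries)

  open JoinLabeling G H g h M
  f = joinLabeling

  valueG : Fin t → ℕ
  valueG l = α l + β l + m * (2 * p + 2 * size G + p * m) + sum (vertexLabel h)

  offset : ℕ
  offset = sum (vertexLabel g) + p * (p * m + 1) / 2 + p * (p + size G)

  valueH : Fin m → ℕ
  valueH j = offset + inducedColor h j + 2 * degree H j * K

  colour-G : ∀ u → inducedColor f (u ↑ˡ m) ≡ valueG (part u)
  colour-G u = trans (inducedColor-G u)
    (cong (λ z → z + m * (2 * p + 2 * size G + p * m) + sum (vertexLabel h))
      (trans (cong (λ z → inducedColor g u + z) (sum-cong-≗ (M≡A′ u))) (proj₂ π-and-sums u)))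

  colour-H : ∀ j → inducedColor f (p ↑ʳ j) ≡ valueH j
  colour-H j = trans (inducedColor-H j)
    (cong (λ z → sum (vertexLabel g) + z + p * (p + size G) + inducedColor h j + 2 * degree H j * K)
      (trans (sum-cong-≗ (λ u → M≡A′ u j))
        -- Permuting rows reorders the terms of a column sum without changing it.
        (trans (sym (sum-permute (λ i → A i j) π)) (A-columns j))))

  valueG-distinct : ∀ {l l′} → l ≢ l′ → valueG l ≢ valueG l′
  valueG-distinct l≢l′ = <-distinct⇒distinct (λ l → α l + β l) α+β-distinct l≢l′
    ∘ ℕₚ.+-cancelʳ-≡ _ _ _ ∘ ℕₚ.+-cancelʳ-≡ _ _ _

  valueH-distinct : ∀ {i j} → i ≢ j → inducedColor h i ≢ inducedColor h j → valueH i ≢ valueH j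
  valueH-distinct {i} {j} i≢j h≢ eq = different-colour i j i≢j h≢
    (difference-of-offsets _ _ (degree H i) (degree H j) K
      (ℕₚ.+-cancelˡ-≡ offset _ _
        (trans (sym (ℕₚ.+-assoc offset _ _)) (trans eq (ℕₚ.+-assoc offset _ _)))))

  valueH-cong : ∀ {i j} → inducedColor h i ≡ inducedColor h j → valueH i ≡ valueH j
  -- Condition (iii) speaks of distinct indices only, so the case `i ≡ j` is split off.
  valueH-cong {i} {j} eq with i Finₚ.≟ j
  ... | yes refl = refl
  ... | no i≢j = cong₂ (λ x y → offset + x + 2 * y * K) eq (same-degree i j i≢j eq)

  independent = IsPartite.independent partite

  upper : χltna J ≲ (t + t′)
  upper = χltna-attained
    -- `2≤p` reads as 1 < p and `3≤m` as 2 < m, so `fromℕ<` gives the vertex of index 1 in G and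
    -- that of index 2 in H; any vertex on each side would do.
    (ℕₚ.≤-trans 2≤p (ℕₚ.m≤m+n p m)) (∨-noIsolated G H (fromℕ< 2≤p) (fromℕ< 3≤m)) f
    (join-ltna G H independent h h-ltna valueG valueG-distinct valueH valueH-cong valueH-distinct
       G≢H f colour-G colour-H)
    (join-numColors G H independent h h-ltna valueG valueG-distinct valueH valueH-cong valueH-distinct
       G≢H f colour-G colour-H)
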